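{- Let $r\ge 2$ and $x\ge 2$ be integers, let $G$ be a $K_r$-free graph on $x$ vertices, and let $\mathcal I$ denote the number of independent sets of $G$ (including the empty set). Then $$\log \mathcal I\;\ge\;\max\left(\frac{x^{1/r}}{2},\ \frac{\log^2 x}{18\log(2r)}\right).$$
   Context: A graph is $K_r$-free if it contains no $r$ pairwise adjacent vertices. Logarithms are base 2. -}

module Defs where

open import Data.Empty using (⊥; ⊥-elim)
open import Data.Fin.Base using (Fin; zero; suc)
open import Data.Fin.Properties using (all?)
open import Data.Fin.Subset using (Subset; inside; outside; _∈_; ∣_∣; ⁅_⁆) renaming (⊥ to ∅)
open import Data.Fin.Subset.Properties using (_∈?_; ∉⊥; x∈⁅x⁆; x∈⁅y⁆⇒x≡y)
open import Data.Integer.Base as ℤ using (+_; -[1+_])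
import Data.Integer.Properties as ℤ
import Data.Integer.Solver as ℤ-Solver
open import Data.List.Base using (List; []; _∷_; _++_; map; filter; length)
import Data.List.Membership.Propositional as List
open import Data.List.Membership.Propositional.Properties using (∈-++⁺ˡ; ∈-++⁺ʳ; ∈-map⁺; ∈-filter⁺)
open import Data.List.Relation.Unary.Any using (here; there)
open import Data.Nat.Base as ℕ using (ℕ; NonZero; NonTrivial)
import Data.Nat.Properties as ℕ
import Data.Nat.Solver as ℕ-Solver
open import Data.Product using (∃; ∃₂; _×_; _,_; proj₁; proj₂)
open import Data.Rational
  using (ℚ; mkℚ; _/_; 0ℚ; 1ℚ; ½; _+_; _*_; _-_; -_; 1/_; _<_; _≤_; *<*; *≤*; positive; nonNegative; toℚᵘ)
open import Data.Rational.Properties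
open import Data.Rational.Solver using (module +-*-Solver)
import Data.Rational.Unnormalised.Base as ℚᵘ
import Data.Rational.Unnormalised.Properties as ℚᵘ
open import Data.Sum.Base using (_⊎_; inj₁; inj₂)
open import Data.Vec.Base using ([]; _∷_)
open import Relation.Binary.Definitions using (Decidable; Symmetric; Irreflexive; tri<; tri≈; tri>)
open import Relation.Binary.PropositionalEquality
open import Relation.Nullary.Decidable using (Dec; yes; no; ¬?; _→-dec_)
open import Relation.Nullary.Negation using (¬_; contradiction)

2*-nonTrivial : ∀ n → .{{NonTrivial n}} → NonTrivial (2 ℕ.* n)
2*-nonTrivial (ℕ.suc n) = subst NonTrivial (sym (ℕ.*-suc 2 n)) _

------------------------------------------------------------------------
-- Graphs

record Graph (n : ℕ) : Set₁ where
  field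
    Adj        : Fin n → Fin n → Set
    adj?       : Decidable Adj
    adj-sym    : Symmetric Adj
    adj-irrefl : Irreflexive _≡_ Adj

module _ {n : ℕ} (G : Graph n) where
  open Graph G

  Clique : Subset n → Set
  Clique S = ∀ u v → u ∈ S → v ∈ S → u ≢ v → Adj u v

  Independent : Subset n → Set
  Independent S = ∀ u v → u ∈ S → v ∈ S → ¬ Adj u v

  independent? : ∀ S → Dec (Independent S)
  independent? S = all? λ u → all? λ v → (u ∈? S) →-dec (v ∈? S) →-dec ¬? (adj? u v)

K[_]-Free : ∀ {n} → ℕ → Graph n → Set
K[ r ]-Free G = ¬ ∃ λ S → ∣ S ∣ ≡ r × Clique G S

-- Every subset of Fin n, each listed once.
subsets : ∀ n → List (Subset n)
subsets ℕ.zero    = [] ∷ []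
subsets (ℕ.suc n) = map (outside ∷_) (subsets n) ++ map (inside ∷_) (subsets n)

numIndependentSets : ∀ {n} → Graph n → ℕ
numIndependentSets {n} G = length (filter (independent? G) (subsets n))

∈-subsets : ∀ {n} (S : Subset n) → S List.∈ subsets n
∈-subsets []            = here refl
∈-subsets (outside ∷ S) = ∈-++⁺ˡ (∈-map⁺ (outside ∷_) (∈-subsets S))
∈-subsets (inside  ∷ S) = ∈-++⁺ʳ _ (∈-map⁺ (inside ∷_) (∈-subsets S))

distinct⇒nonTrivial : ∀ {A : Set} {x y : A} {xs : List A} →
                      x List.∈ xs → y List.∈ xs → x ≢ y → NonTrivial (length xs)
distinct⇒nonTrivial (here refl) (here refl) x≢y = contradiction refl x≢y
distinct⇒nonTrivial {xs = _ ∷ _ ∷ _} _ _ _ = _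
distinct⇒nonTrivial {xs = _ ∷ []} (here _) (there ()) _
distinct⇒nonTrivial {xs = _ ∷ []} (there ()) _ _

-- The empty set and any single vertex are independent.
numIndependentSets-nonTrivial : ∀ {n} .{{_ : NonTrivial n}} (G : Graph n) → NonTrivial (numIndependentSets G)
numIndependentSets-nonTrivial {ℕ.suc n} G = distinct⇒nonTrivial
  (∈-filter⁺ (independent? G) (∈-subsets ∅) λ u v u∈∅ → contradiction u∈∅ ∉⊥)
  (∈-filter⁺ (independent? G) (∈-subsets ⁅ zero ⁆) λ u v u∈ v∈ →
    Graph.adj-irrefl G (trans (x∈⁅y⁆⇒x≡y zero u∈) (sym (x∈⁅y⁆⇒x≡y zero v∈))))
  λ ∅≡⁅0⁆ → ∉⊥ (subst (zero ∈_) (sym ∅≡⁅0⁆) (x∈⁅x⁆ zero))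

------------------------------------------------------------------------
-- Positive real numbers, as Dedekind cuts: Lower x q says q < x and Upper x q
-- says x < q. Positivity is lower-0.

record ℝ⁺ : Set₁ where
  field
    Lower Upper : ℚ → Set
    lower-0     : Lower 0ℚ
    upper-∃     : ∃ Upper
    lower-down  : ∀ {p q} → p < q → Lower q → Lower p
    upper-up    : ∀ {p q} → p < q → Upper p → Upper q
    lower-open  : ∀ {p} → Lower p → ∃ λ q → p < q × Lower q
    upper-open  : ∀ {q} → Upper q → ∃ λ p → p < q × Upper p
    disjoint    : ∀ {q} → Lower q → Upper q → ⊥
    located     : ∀ {p q} → p < q → Lower p ⊎ Upper q

  lower<upper : ∀ {p q} → Lower p → Upper q → p < q
  lower<upper {p} {q} Lp Uq with <-cmp p q
  ... | tri< p<q _ _  = p<q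
  ... | tri≈ _ refl _ = ⊥-elim (disjoint Lp Uq)
  ... | tri> _ _ q<p  = ⊥-elim (disjoint (lower-down q<p Lp) Uq)

  upper-pos : ∀ {q} → Upper q → 0ℚ < q
  upper-pos = lower<upper lower-0

open ℝ⁺

infix 4 _≤ᴿ_

_≤ᴿ_ : ℝ⁺ → ℝ⁺ → Set
x ≤ᴿ y = ∀ q → Lower x q → Lower y q

------------------------------------------------------------------------
-- Auxiliary facts about ℚ

*ʳ-< : ∀ p q r → 0ℚ < r → p < q → p * r < q * r
*ʳ-< p q r 0<r = *-monoˡ-<-pos r {{positive 0<r}} {p} {q}

*ˡ-< : ∀ p q r → 0ℚ < r → p < q → r * p < r * q
*ˡ-< p q r 0<r = *-monoʳ-<-pos r {{positive 0<r}} {p} {q}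

*ʳ-cancel-< : ∀ p q r → 0ℚ < r → p * r < q * r → p < q
*ʳ-cancel-< p q r 0<r = *-cancelʳ-<-nonNeg r {{nonNegative (<⇒≤ 0<r)}} {p} {q}

*-pos : ∀ p q → 0ℚ < p → 0ℚ < q → 0ℚ < p * q
*-pos p q 0<p 0<q = subst (_< p * q) (*-zeroˡ q) (*ʳ-< 0ℚ p q 0<q 0<p)

<+1 : ∀ q → q < q + 1ℚ
<+1 q = subst (_< q + 1ℚ) (+-identityʳ q) (+-monoʳ-< q {0ℚ} {1ℚ} (*<* (ℤ.+<+ (ℕ.s≤s ℕ.z≤n))))

quotient : ∀ p {q} → 0ℚ < q → ∃ λ r → r * q ≡ p
quotient p {q} 0<q = p * 1/ q , trans (*-assoc p (1/ q) q) (trans (cong (p *_) (*-inverseˡ q)) (*-identityʳ p))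
  where instance _ = pos⇒nonZero q {{positive 0<q}}

interpolate : ∀ q {r s} → 0ℚ < r → q * r < s → ∃ λ t → q < t × t * r < s
interpolate q {r} 0<r qr<s with <-dense qr<s
... | m , qr<m , m<s with quotient m 0<r
... | t , refl = t , *ʳ-cancel-< q t r 0<r qr<m , m<s

interpolate′ : ∀ q {r s} → 0ℚ < r → s < q * r → ∃ λ t → t < q × s < t * r
interpolate′ q {r} 0<r s<qr with <-dense s<qr
... | m , s<m , m<qr with quotient m 0<r
... | t , refl = t , *ʳ-cancel-< t q r 0<r m<qr , s<m

fraction : ℕ → ℕ → ℚ
fraction p k = + p / ℕ.suc k

fraction-≤ : ∀ p k p′ k′ → p ℕ.* ℕ.suc k′ ℕ.≤ p′ ℕ.* ℕ.suc k → fraction p k ≤ fraction p′ k′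
fraction-≤ p k p′ k′ le = toℚᵘ-cancel-≤ (begin
  toℚᵘ (fraction p k)    ≃⟨ toℚᵘ-fromℚᵘ (ℚᵘ.mkℚᵘ (+ p) k) ⟩
  ℚᵘ.mkℚᵘ (+ p) k        ≤⟨ ℚᵘ.*≤* (subst₂ ℤ._≤_ (ℤ.pos-* p (ℕ.suc k′)) (ℤ.pos-* p′ (ℕ.suc k)) (ℤ.+≤+ le)) ⟩
  ℚᵘ.mkℚᵘ (+ p′) k′      ≃⟨ toℚᵘ-fromℚᵘ (ℚᵘ.mkℚᵘ (+ p′) k′) ⟨
  toℚᵘ (fraction p′ k′)  ∎)
  where open ℚᵘ.≤-Reasoning

nonNeg⇒fraction : ∀ {q} → 0ℚ ≤ q → ∃₂ λ p k → fraction p k ≡ q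
nonNeg⇒fraction {q@(mkℚ (+ p) k _)}   _ = p , k , ↥p/↧p≡p q
nonNeg⇒fraction {mkℚ -[1+ _ ] _ _} (*≤* ())

fraction-suc : ∀ n → fraction (ℕ.suc n) 0 ≡ 1ℚ + fraction n 0
fraction-suc n = toℚᵘ-injective (begin
  toℚᵘ (fraction (ℕ.suc n) 0)        ≈⟨ toℚᵘ-fromℚᵘ (ℚᵘ.mkℚᵘ (+ ℕ.suc n) 0) ⟩
  ℚᵘ.mkℚᵘ (+ ℕ.suc n) 0              ≈⟨ ℚᵘ.*≡* (lemma (+ n)) ⟩
  ℚᵘ.1ℚᵘ ℚᵘ.+ ℚᵘ.mkℚᵘ (+ n) 0        ≈⟨ ℚᵘ.+-congʳ ℚᵘ.1ℚᵘ (toℚᵘ-fromℚᵘ (ℚᵘ.mkℚᵘ (+ n) 0)) ⟨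
  toℚᵘ 1ℚ ℚᵘ.+ toℚᵘ (fraction n 0)   ≈⟨ toℚᵘ-homo-+ 1ℚ (fraction n 0) ⟨
  toℚᵘ (1ℚ + fraction n 0)           ∎)
  where
  open ℚᵘ.≃-Reasoning
  open ℤ-Solver.+-*-Solver
  lemma : ∀ i → (+ 1 ℤ.+ i) ℤ.* (+ 1) ≡ (+ 1 ℤ.+ i ℤ.* + 1) ℤ.* + 1
  lemma = solve 1 (λ i → (con (+ 1) :+ i) :* con (+ 1) := (con (+ 1) :+ i :* con (+ 1)) :* con (+ 1)) refl

archimedean : ∀ q → ∃ λ n → q ≤ fraction n 0
archimedean q with ≤-total q 0ℚ
... | inj₁ q≤0 = 0 , q≤0
... | inj₂ 0≤q with nonNeg⇒fraction 0≤q
...   | p , k , refl = p , fraction-≤ p k p 0 (ℕ.*-monoʳ-≤ p (ℕ.s≤s (ℕ.z≤n {k})))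

-- x can be bracketed to within any rational ratio q / p > 1.
approximate : ∀ x {p q} → 0ℚ < p → p < q → ∃₂ λ a b → 0ℚ < a × Lower x a × Upper x b × p * b < q * a
approximate x {p} {q} 0<p p<q with lower-open x (lower-0 x) | upper-∃ x
... | a₀ , 0<a₀ , La₀ | b₀ , Ub₀
  with interpolate a₀ 0<p (subst (_< q * a₀) (*-comm p a₀) (*ʳ-< p q a₀ 0<a₀ p<q))
... | a₁ , a₀<a₁ , a₁p<qa₀ = walk n (a₀ , 0<a₀ , La₀ , step-a₀) Ub′
  where
  open +-*-Solver
  δ : ℚ
  δ = ½ * (a₁ - a₀)

  δ>0 : 0ℚ < δ
  δ>0 = *-pos ½ (a₁ - a₀) (*<* (ℤ.+<+ (ℕ.s≤s ℕ.z≤n))) (subst (_< a₁ - a₀) (+-inverseʳ a₀) (+-monoˡ-< (- a₀) {a₀} {a₁} a₀<a₁))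

  step : ℚ → ℚ
  step a = δ + (δ + a)

  <step : ∀ a → a < δ + a
  <step a = subst (_< δ + a) (+-identityˡ a) (+-monoˡ-< a δ>0)

  Close : ℚ → Set
  Close a = p * step a < q * a

  step-a₀ : Close a₀
  step-a₀ = subst (_< q * a₀) (solve 3 (λ a b c → b :* c := c :* (con ½ :* (b :- a) :+ (con ½ :* (b :- a) :+ a))) refl a₀ a₁ p) a₁p<qa₀

  step-step : ∀ {a} → Close a → Close (δ + a)
  step-step {a} close = subst₂ _<_
    (solve 3 (λ p d a → p :* d :+ p :* (d :+ (d :+ a)) := p :* (d :+ (d :+ (d :+ a)))) refl p δ a)
    (sym (*-distribˡ-+ q δ a))
    (+-mono-< (*ʳ-< p q δ δ>0 p<q) close)

  Start : Set
  Start = ∃ λ a → 0ℚ < a × Lower x a × Close a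

  walk : ∀ n (s : Start) → Upper x (fraction n 0 * δ + proj₁ s) →
         ∃₂ λ a b → 0ℚ < a × Lower x a × Upper x b × p * b < q * a
  walk ℕ.zero (a , 0<a , La , close) U =
    ⊥-elim (disjoint x La (subst (Upper x) (trans (cong (_+ a) (*-zeroˡ δ)) (+-identityˡ a)) U))
  walk (ℕ.suc n) (a , 0<a , La , close) U with located x (<step (δ + a))
  ... | inj₂ U′ = a , step a , 0<a , La , U′ , close
  ... | inj₁ L′ = walk n (δ + a , <-trans 0<a (<step a) , L′ , step-step close)
    (subst (Upper x) (trans (cong (λ m → m * δ + a) (fraction-suc n))
      (solve 3 (λ m d a → (con 1ℚ :+ m) :* d :+ a := m :* d :+ (d :+ a)) refl (fraction n 0) δ a)) U)

  k : ∃ λ r → r * δ ≡ b₀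
  k = quotient b₀ δ>0

  n : ℕ
  n = proj₁ (archimedean (proj₁ k))

  Ub′ : Upper x (fraction n 0 * δ + a₀)
  Ub′ = upper-up x (≤-<-trans (subst (_≤ fraction n 0 * δ) (proj₂ k)
          (*-monoʳ-≤-nonNeg δ {{nonNegative (<⇒≤ δ>0)}} (proj₂ (archimedean (proj₁ k)))))
          (subst (_< fraction n 0 * δ + a₀) (+-identityʳ _) (+-monoʳ-< (fraction n 0 * δ) 0<a₀))) Ub₀

------------------------------------------------------------------------
-- Arithmetic of positive reals

infixl 7 _*ᴿ_ _/ᴿ_
infixl 6 _⊔ᴿ_
infix  8 _²

_*ᴿ_ : ℝ⁺ → ℝ⁺ → ℝ⁺
x *ᴿ y = record
  { Lower      = λ q → ∃₂ λ a b → 0ℚ < a × Lower x a × 0ℚ < b × Lower y b × q < a * b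
  ; Upper      = λ q → ∃₂ λ a b → Upper x a × Upper y b × a * b < q
  ; lower-0    = low-0
  ; upper-∃    = let (a , Ua) = upper-∃ x
                     (b , Ub) = upper-∃ y
                 in a * b + 1ℚ , a , b , Ua , Ub , <+1 (a * b)
  ; lower-down = λ { p<q (a , b , 0<a , La , 0<b , Lb , q<ab) → a , b , 0<a , La , 0<b , Lb , <-trans p<q q<ab }
  ; upper-up   = λ { p<q (a , b , Ua , Ub , ab<p) → a , b , Ua , Ub , <-trans ab<p p<q }
  ; lower-open = λ { (a , b , 0<a , La , 0<b , Lb , p<ab) →
                   let (q , p<q , q<ab) = <-dense p<ab in q , p<q , a , b , 0<a , La , 0<b , Lb , q<ab }
  ; upper-open = λ { (a , b , Ua , Ub , ab<q) →
                   let (p , ab<p , p<q) = <-dense ab<q in p , p<q , a , b , Ua , Ub , ab<p }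
  ; disjoint   = λ { (a , b , 0<a , La , 0<b , Lb , q<ab) (a′ , b′ , Ua′ , Ub′ , a′b′<q) →
                   <-asym (<-trans a′b′<q q<ab)
                     (<-trans (*ʳ-< a a′ b 0<b (lower<upper x La Ua′)) (*ˡ-< b b′ a′ (upper-pos x Ua′) (lower<upper y Lb Ub′))) }
  ; located    = loc
  }
  where
  Low Up : ℚ → Set
  Low q = ∃₂ λ a b → 0ℚ < a × Lower x a × 0ℚ < b × Lower y b × q < a * b
  Up  q = ∃₂ λ a b → Upper x a × Upper y b × a * b < q

  low-0 : Low 0ℚ
  low-0 = let (a , 0<a , La) = lower-open x (lower-0 x)
              (b , 0<b , Lb) = lower-open y (lower-0 y)
          in a , b , 0<a , La , 0<b , Lb , *-pos a b 0<a 0<b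

  decide : ∀ p q a b s t → 0ℚ < p → 0ℚ < a → Lower x a → Upper x b → s * a ≡ p → t * b ≡ q →
           Lower y s ⊎ Upper y t → Low p ⊎ Up q
  decide p q a b s t 0<p 0<a La Ub sa≡p tb≡q (inj₁ Ls) =
    let (c , s<c , Lc) = lower-open y Ls
        0<s = *ʳ-cancel-< 0ℚ s a 0<a (subst₂ _<_ (sym (*-zeroˡ a)) (sym sa≡p) 0<p)
    in inj₁ (a , c , 0<a , La , <-trans 0<s s<c , Lc , subst₂ _<_ sa≡p (*-comm c a) (*ʳ-< s c a 0<a s<c))
  decide p q a b s t 0<p 0<a La Ub sa≡p tb≡q (inj₂ Ut) =
    let (d , d<t , Ud) = upper-open y Ut
    in inj₂ (b , d , Ub , Ud , subst₂ _<_ (*-comm d b) tb≡q (*ʳ-< d t b (upper-pos x Ub) d<t))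

  loc⁺ : ∀ {p q} → 0ℚ < p → p < q → Low p ⊎ Up q
  loc⁺ {p} {q} 0<p p<q =
    let (a , b , 0<a , La , Ub , pb<qa) = approximate x 0<p p<q
        0<b = upper-pos x Ub
        (s , sa≡p) = quotient p 0<a
        (t , tb≡q) = quotient q 0<b
    in decide p q a b s t 0<p 0<a La Ub sa≡p tb≡q
         (located y (*ʳ-cancel-< s t (a * b) (*-pos a b 0<a 0<b) (subst₂ _<_
           (trans (cong (_* b) (sym sa≡p)) (*-assoc s a b))
           (trans (cong (_* a) (sym tb≡q)) (trans (*-assoc t b a) (cong (t *_) (*-comm b a))))
           pb<qa)))

  loc : ∀ {p q} → p < q → Low p ⊎ Up q
  loc {p} {q} p<q with 0ℚ <? p
  ... | yes 0<p = loc⁺ 0<p p<q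
  ... | no  p≤0 = let (a , b , 0<a , La , 0<b , Lb , 0<ab) = low-0
                  in inj₁ (a , b , 0<a , La , 0<b , Lb , ≤-<-trans (≮⇒≥ p≤0) 0<ab)

_/ᴿ_ : ℝ⁺ → ℝ⁺ → ℝ⁺
x /ᴿ y = record
  { Lower      = λ q → ∃₂ λ a b → Lower x a × Upper y b × q * b < a
  ; Upper      = λ q → ∃₂ λ a b → Upper x a × 0ℚ < b × Lower y b × a < q * b
  ; lower-0    = low-≤0 ≤-refl
  ; upper-∃    = let (a , Ua) = upper-∃ x
                     (b , 0<b , Lb) = lower-open y (lower-0 y)
                     (q , qb≡a+1) = quotient (a + 1ℚ) 0<b
                 in q , a , b , Ua , 0<b , Lb , subst (a <_) (sym qb≡a+1) (<+1 a)
  ; lower-down = λ { {p} {q} p<q (a , b , La , Ub , qb<a) → a , b , La , Ub , <-trans (*ʳ-< p q b (upper-pos y Ub) p<q) qb<a }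
  ; upper-up   = λ { {p} {q} p<q (a , b , Ua , 0<b , Lb , a<pb) → a , b , Ua , 0<b , Lb , <-trans a<pb (*ʳ-< p q b 0<b p<q) }
  ; lower-open = λ { {p} (a , b , La , Ub , pb<a) →
                   let (q , p<q , qb<a) = interpolate p (upper-pos y Ub) pb<a in q , p<q , a , b , La , Ub , qb<a }
  ; upper-open = λ { {q} (a , b , Ua , 0<b , Lb , a<qb) →
                   let (p , p<q , a<pb) = interpolate′ q 0<b a<qb in p , p<q , a , b , Ua , 0<b , Lb , a<pb }
  ; disjoint   = λ { {q} (a , b , La , Ub , qb<a) (a′ , b′ , Ua′ , 0<b′ , Lb′ , a′<qb′) →
                   let 0<q = *ʳ-cancel-< 0ℚ q b′ 0<b′ (subst (_< q * b′) (sym (*-zeroˡ b′)) (<-trans (upper-pos x Ua′) a′<qb′))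
                   in <-asym (<-trans qb<a (<-trans (lower<upper x La Ua′) a′<qb′)) (*ˡ-< b′ b q 0<q (lower<upper y Lb′ Ub)) }
  ; located    = loc
  }
  where
  Low Up : ℚ → Set
  Low q = ∃₂ λ a b → Lower x a × Upper y b × q * b < a
  Up  q = ∃₂ λ a b → Upper x a × 0ℚ < b × Lower y b × a < q * b

  low-≤0 : ∀ {p} → p ≤ 0ℚ → Low p
  low-≤0 {p} p≤0 =
    let (a , 0<a , La) = lower-open x (lower-0 x)
        (b , Ub) = upper-∃ y
        pb≤0b = *-monoʳ-≤-nonNeg b {{nonNegative (<⇒≤ (upper-pos y Ub))}} {p} {0ℚ} p≤0
    in a , b , La , Ub , ≤-<-trans pb≤0b (subst (_< a) (sym (*-zeroˡ b)) 0<a)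

  decide : ∀ p q c d → 0ℚ < c → Lower y c → Upper y d → Lower x (p * d) ⊎ Upper x (q * c) → Low p ⊎ Up q
  decide p q c d 0<c Lc Ud (inj₁ L) = let (a , pd<a , La) = lower-open x L in inj₁ (a , d , La , Ud , pd<a)
  decide p q c d 0<c Lc Ud (inj₂ U) = let (a , a<qc , Ua) = upper-open x U in inj₂ (a , c , Ua , 0<c , Lc , a<qc)

  loc⁺ : ∀ {p q} → 0ℚ < p → p < q → Low p ⊎ Up q
  loc⁺ {p} {q} 0<p p<q =
    let (c , d , 0<c , Lc , Ud , pd<qc) = approximate y 0<p p<q
    in decide p q c d 0<c Lc Ud (located x pd<qc)

  loc : ∀ {p q} → p < q → Low p ⊎ Up q
  loc {p} {q} p<q with 0ℚ <? p
  ... | yes 0<p = loc⁺ 0<p p<q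
  ... | no  p≤0 = inj₁ (low-≤0 (≮⇒≥ p≤0))

_² : ℝ⁺ → ℝ⁺
x ² = x *ᴿ x

_⊔ᴿ_ : ℝ⁺ → ℝ⁺ → ℝ⁺
x ⊔ᴿ y = record
  { Lower      = λ q → Lower x q ⊎ Lower y q
  ; Upper      = Up
  ; lower-0    = inj₁ (lower-0 x)
  ; upper-∃    = let (a , Ua) = upper-∃ x
                     (b , Ub) = upper-∃ y
                     (c , Uc , _) = join Ua Ub
                 in c , Uc
  ; lower-down = λ { p<q (inj₁ L) → inj₁ (lower-down x p<q L) ; p<q (inj₂ L) → inj₂ (lower-down y p<q L) }
  ; upper-up   = λ { p<q (U , V) → upper-up x p<q U , upper-up y p<q V }
  ; lower-open = λ { (inj₁ L) → let (q , p<q , L′) = lower-open x L in q , p<q , inj₁ L′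
                   ; (inj₂ L) → let (q , p<q , L′) = lower-open y L in q , p<q , inj₂ L′ }
  ; upper-open = λ { (U , V) → let (a , a<q , Ua) = upper-open x U
                                   (b , b<q , Ub) = upper-open y V
                                   (c , Uc , bound) = join Ua Ub
                               in c , bound a<q b<q , Uc }
  ; disjoint   = λ { (inj₁ L) (U , V) → disjoint x L U ; (inj₂ L) (U , V) → disjoint y L V }
  ; located    = loc
  }
  where
  Up : ℚ → Set
  Up q = Upper x q × Upper y q

  join : ∀ {a b} → Upper x a → Upper y b → ∃ λ c → Up c × (∀ {q} → a < q → b < q → c < q)
  join {a} {b} Ua Ub with <-cmp a b
  ... | tri< a<b _ _  = b , (upper-up x a<b Ua , Ub) , λ _ b<q → b<q
  ... | tri≈ _ refl _ = a , (Ua , Ub) , λ a<q _ → a<q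
  ... | tri> _ _ b<a  = a , (Ua , upper-up y b<a Ub) , λ a<q _ → a<q

  loc : ∀ {p q} → p < q → (Lower x p ⊎ Lower y p) ⊎ Up q
  loc p<q with located x p<q | located y p<q
  ... | inj₁ L | _      = inj₁ (inj₁ L)
  ... | inj₂ _ | inj₁ L = inj₁ (inj₂ L)
  ... | inj₂ U | inj₂ V = inj₂ (U , V)

------------------------------------------------------------------------
-- Reals given by comparison with fractions

-- The real α > 0 for which  below p d  says  p / d ≤ α  and  above p d  says
-- α ≤ p / d,  for all natural p and d with d > 0.
module Compare
  (below above : ℕ → ℕ → Set)
  (total   : ∀ p k → below p (ℕ.suc k) ⊎ above p (ℕ.suc k))
  (ordered : ∀ {p k p′ k′} → below p (ℕ.suc k) → above p′ (ℕ.suc k′) → p ℕ.* ℕ.suc k′ ℕ.≤ p′ ℕ.* ℕ.suc k)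
  (below-1 : below 1 1)
  (above-∃ : ∃ λ p → above p 1)
  where

  Low Up : ℚ → Set
  Low q = ∃₂ λ p k → below p (ℕ.suc k) × q < fraction p k
  Up  q = ∃₂ λ p k → above p (ℕ.suc k) × fraction p k < q

  low-0 : Low 0ℚ
  low-0 = 1 , 0 , below-1 , *<* (ℤ.+<+ (ℕ.s≤s ℕ.z≤n))

  loc⁺ : ∀ {p m q} → 0ℚ ≤ m → p < m → m < q → Low p ⊎ Up q
  loc⁺ 0≤m p<m m<q with nonNeg⇒fraction 0≤m
  ... | n , k , refl with total n k
  ... | inj₁ b = inj₁ (n , k , b , p<m)
  ... | inj₂ a = inj₂ (n , k , a , m<q)

  loc : ∀ {p q} → p < q → Low p ⊎ Up q
  loc {p} p<q with 0ℚ <? p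
  ... | yes 0<p = let (m , p<m , m<q) = <-dense p<q in loc⁺ (<⇒≤ (<-trans 0<p p<m)) p<m m<q
  ... | no  p≤0 = let (n , k , b , 0<n/k) = low-0 in inj₁ (n , k , b , ≤-<-trans (≮⇒≥ p≤0) 0<n/k)

  real : ℝ⁺
  real = record
    { Lower      = Low
    ; Upper      = Up
    ; lower-0    = low-0
    ; upper-∃    = let (p , a) = above-∃ in fraction p 0 + 1ℚ , p , 0 , a , <+1 (fraction p 0)
    ; lower-down = λ { p<q (n , k , b , q<) → n , k , b , <-trans p<q q< }
    ; upper-up   = λ { p<q (n , k , a , <p) → n , k , a , <-trans <p p<q }
    ; lower-open = λ { (n , k , b , p<) → let (q , p<q , q<) = <-dense p< in q , p<q , n , k , b , q< }
    ; upper-open = λ { (n , k , a , <q) → let (p , <p , p<q) = <-dense <q in p , p<q , n , k , a , <p }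
    ; disjoint   = λ { (p , k , b , q<) (p′ , k′ , a , <q) →
                       <-irrefl refl (<-≤-trans (<-trans <q q<) (fraction-≤ p k p′ k′ (ordered b a))) }
    ; located    = loc
    }

fromℕ : (n : ℕ) .{{_ : NonZero n}} → ℝ⁺
fromℕ n = Compare.real
  (λ p d → p ℕ.≤ n ℕ.* d)
  (λ p d → n ℕ.* d ℕ.≤ p)
  (λ p k → ℕ.≤-total p (n ℕ.* ℕ.suc k))
  (λ {p} {k} {p′} {k′} b a → begin
    p ℕ.* ℕ.suc k′                ≤⟨ ℕ.*-monoˡ-≤ (ℕ.suc k′) b ⟩
    n ℕ.* ℕ.suc k ℕ.* ℕ.suc k′    ≡⟨ ℕ.*-assoc n _ _ ⟩
    n ℕ.* (ℕ.suc k ℕ.* ℕ.suc k′)  ≡⟨ cong (n ℕ.*_) (ℕ.*-comm (ℕ.suc k) _) ⟩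
    n ℕ.* (ℕ.suc k′ ℕ.* ℕ.suc k)  ≡⟨ ℕ.*-assoc n _ _ ⟨
    n ℕ.* ℕ.suc k′ ℕ.* ℕ.suc k    ≤⟨ ℕ.*-monoˡ-≤ (ℕ.suc k) a ⟩
    p′ ℕ.* ℕ.suc k                ∎)
  (subst (1 ℕ.≤_) (sym (ℕ.*-identityʳ n)) (ℕ.>-nonZero⁻¹ n))
  (n ℕ.* 1 , ℕ.≤-refl)
  where open ℕ.≤-Reasoning

-- p / d ≤ log₂ n  iff  2 ^ p ≤ n ^ d.
log₂ : (n : ℕ) .{{_ : NonTrivial n}} → ℝ⁺
log₂ n = Compare.real
  (λ p d → 2 ℕ.^ p ℕ.≤ n ℕ.^ d)
  (λ p d → n ℕ.^ d ℕ.≤ 2 ℕ.^ p)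
  (λ p k → ℕ.≤-total (2 ℕ.^ p) (n ℕ.^ ℕ.suc k))
  (λ {p} {k} {p′} {k′} b a → ℕ.≮⇒≥ λ lt → ℕ.<⇒≱ (ℕ.^-monoʳ-< 2 (ℕ.s≤s (ℕ.s≤s ℕ.z≤n)) lt) (begin
    2 ℕ.^ (p ℕ.* ℕ.suc k′)            ≡⟨ ℕ.^-*-assoc 2 p (ℕ.suc k′) ⟨
    (2 ℕ.^ p) ℕ.^ ℕ.suc k′            ≤⟨ ℕ.^-monoˡ-≤ (ℕ.suc k′) b ⟩
    (n ℕ.^ ℕ.suc k) ℕ.^ ℕ.suc k′      ≡⟨ ℕ.^-*-assoc n (ℕ.suc k) (ℕ.suc k′) ⟩
    n ℕ.^ (ℕ.suc k ℕ.* ℕ.suc k′)      ≡⟨ cong (n ℕ.^_) (ℕ.*-comm (ℕ.suc k) (ℕ.suc k′)) ⟩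
    n ℕ.^ (ℕ.suc k′ ℕ.* ℕ.suc k)      ≡⟨ ℕ.^-*-assoc n (ℕ.suc k′) (ℕ.suc k) ⟨
    (n ℕ.^ ℕ.suc k′) ℕ.^ ℕ.suc k      ≤⟨ ℕ.^-monoˡ-≤ (ℕ.suc k) a ⟩
    (2 ℕ.^ p′) ℕ.^ ℕ.suc k            ≡⟨ ℕ.^-*-assoc 2 p′ (ℕ.suc k) ⟩
    2 ℕ.^ (p′ ℕ.* ℕ.suc k)            ∎))
  (subst (2 ℕ.≤_) (sym (ℕ.^-identityʳ n)) (ℕ.nonTrivial⇒n>1 n))
  (n , subst (ℕ._≤ 2 ℕ.^ n) (sym (ℕ.^-identityʳ n)) (n≤2^n n))
  where
  open ℕ.≤-Reasoning
  n≤2^n : ∀ n → n ℕ.≤ 2 ℕ.^ n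
  n≤2^n ℕ.zero    = ℕ.z≤n
  n≤2^n (ℕ.suc n) = begin
    1 ℕ.+ n              ≤⟨ ℕ.+-mono-≤ (ℕ.m^n>0 2 n) (n≤2^n n) ⟩
    2 ℕ.^ n ℕ.+ 2 ℕ.^ n  ≡⟨ cong (2 ℕ.^ n ℕ.+_) (ℕ.+-identityʳ (2 ℕ.^ n)) ⟨
    2 ℕ.^ ℕ.suc n        ∎

-- p / d ≤ x ^ (1 / r)  iff  p ^ r ≤ x d ^ r.
root : (r x : ℕ) .{{_ : NonZero r}} .{{_ : NonZero x}} → ℝ⁺
root r x = Compare.real
  (λ p d → p ℕ.^ r ℕ.≤ x ℕ.* d ℕ.^ r)
  (λ p d → x ℕ.* d ℕ.^ r ℕ.≤ p ℕ.^ r)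
  (λ p k → ℕ.≤-total (p ℕ.^ r) (x ℕ.* ℕ.suc k ℕ.^ r))
  (λ {p} {k} {p′} {k′} b a → ℕ.≮⇒≥ λ lt → ℕ.<⇒≱ (ℕ.^-monoˡ-< r lt) (begin
    (p ℕ.* ℕ.suc k′) ℕ.^ r                  ≡⟨ ^-distribʳ-* p (ℕ.suc k′) r ⟩
    p ℕ.^ r ℕ.* ℕ.suc k′ ℕ.^ r              ≤⟨ ℕ.*-monoˡ-≤ (ℕ.suc k′ ℕ.^ r) b ⟩
    x ℕ.* ℕ.suc k ℕ.^ r ℕ.* ℕ.suc k′ ℕ.^ r  ≡⟨ swap x (ℕ.suc k ℕ.^ r) (ℕ.suc k′ ℕ.^ r) ⟩
    x ℕ.* ℕ.suc k′ ℕ.^ r ℕ.* ℕ.suc k ℕ.^ r  ≤⟨ ℕ.*-monoˡ-≤ (ℕ.suc k ℕ.^ r) a ⟩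
    p′ ℕ.^ r ℕ.* ℕ.suc k ℕ.^ r              ≡⟨ ^-distribʳ-* p′ (ℕ.suc k) r ⟨
    (p′ ℕ.* ℕ.suc k) ℕ.^ r                  ∎))
  (begin
    1 ℕ.^ r          ≡⟨ ℕ.^-zeroˡ r ⟩
    1                ≤⟨ ℕ.>-nonZero⁻¹ x ⟩
    x                ≡⟨ x1 ⟨
    x ℕ.* 1 ℕ.^ r    ∎)
  (x , (begin
    x ℕ.* 1 ℕ.^ r    ≡⟨ x1 ⟩
    x                ≡⟨ ℕ.^-identityʳ x ⟨
    x ℕ.^ 1          ≤⟨ ℕ.^-monoʳ-≤ x (ℕ.>-nonZero⁻¹ r) ⟩
    x ℕ.^ r          ∎))
  where
  open ℕ.≤-Reasoning
  open ℕ-Solver.+-*-Solver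

  x1 : x ℕ.* 1 ℕ.^ r ≡ x
  x1 = trans (cong (x ℕ.*_) (ℕ.^-zeroˡ r)) (ℕ.*-identityʳ x)

  swap : ∀ a b c → a ℕ.* b ℕ.* c ≡ a ℕ.* c ℕ.* b
  swap = solve 3 (λ a b c → a :* b :* c := a :* c :* b) refl

  ^-distribʳ-* : ∀ a b n → (a ℕ.* b) ℕ.^ n ≡ a ℕ.^ n ℕ.* b ℕ.^ n
  ^-distribʳ-* a b ℕ.zero    = refl
  ^-distribʳ-* a b (ℕ.suc n) = trans (cong (a ℕ.* b ℕ.*_) (^-distribʳ-* a b n))
    (solve 4 (λ a b c d → a :* b :* (c :* d) := a :* c :* (b :* d)) refl a b (a ℕ.^ n) (b ℕ.^ n))

{-# OPTIONS --safe #-}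

-- Both bounds rest on one greedy argument: in a vertex set W with |W| > k d, either some v ∈ W
-- has at least d non-neighbours in W, or repeatedly passing to neighbourhoods yields a clique of
-- size k + 1. Applied to the complement it gives the Ramsey bound x < (α + 1)^(r - 1) for the
-- independence number α, hence x ≤ (2α)^r, while ℐ ≥ 2^α.
--
-- For the second bound, let J(m) be the least number of independent sets of a K_r-free graph on
-- m vertices, and let v have at least d non-neighbours. Splitting the independent sets according
-- to whether they contain v gives J(m) ≥ J(m - 1) + J(d); iterating this gives
-- J((r - 1) d + j) ≥ j J(d). With q = 2r, d = q^i and j = r q^i this yields
-- J(q^(i + 1)) ≥ r q^i J(q^i), so J(q^i)² ≥ q^(i²) by induction. If q^i ≤ x < q^s for s = i + 1,
-- then x^s ≤ q^(s²) ≤ q^(9 i²) ≤ ℐ^18 (for i = 0 use ℐ ≥ x), so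
-- 18 log ℐ ≥ s log x ≥ log² x / log q.
module Submission where

open import Defs
open import Data.Nat using (ℕ; NonTrivial; nonTrivial⇒nonZero; _*_)

import Data.Bool.Properties as Bool
open import Data.Empty using (⊥-elim)
open import Data.Fin.Base using (Fin; zero; suc)
import Data.Fin.Properties as Fin
open import Data.Fin.Subset using (Subset; inside; outside; _∈_; _∉_; ∣_∣) renaming (⊥ to ∅)
open import Data.Fin.Subset.Properties using (∉⊥; ∣⊥∣≡0)
import Data.Integer.Base as ℤ
import Data.Integer.Properties as ℤ
open import Data.List.Base using (List; []; _∷_; _++_; map; filter; foldr; length; allFin)
import Data.List.Membership.Propositional as List
open import Data.List.Membership.Propositional.Properties using (∈-filter⁺; ∈-filter⁻)
open import Data.List.Properties using (filter-all; filter-notAll; length-++; length-map; length-tabulate; map-∘; map-id-local)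
open import Data.List.Relation.Binary.Subset.Propositional using (_⊆_)
open import Data.List.Relation.Binary.Subset.Propositional.Properties using (filter-⊆; All-resp-⊇)
open import Data.List.Relation.Unary.All as All using (All; []; _∷_)
import Data.List.Relation.Unary.All.Properties as All
open import Data.List.Relation.Unary.AllPairs as AllPairs using (AllPairs; []; _∷_)
import Data.List.Relation.Unary.AllPairs.Properties as AllPairs
open import Data.List.Relation.Unary.Any as Any using (here; there)
open import Data.List.Relation.Unary.Unique.Propositional using (Unique)
import Data.List.Relation.Unary.Unique.Propositional.Properties as Unique
open import Data.Nat.Base using (zero; suc; _+_; _^_; _≤_; _<_; z≤n; s≤s; NonZero; >-nonZero; nonTrivial⇒n>1)
open import Data.Nat.Properties
open import Data.Nat.Solver using (module +-*-Solver)
open import Data.Product using (∃; ∃₂; _×_; _,_; proj₁; proj₂)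
open import Data.Rational.Base as ℚ using (ℚ; 0ℚ; toℚᵘ)
import Data.Rational.Properties as ℚ
import Data.Rational.Solver as ℚ-Solver
import Data.Rational.Unnormalised.Base as ℚᵘ
import Data.Rational.Unnormalised.Properties as ℚᵘ
open import Data.Sum.Base using (_⊎_; inj₁; inj₂)
import Data.Sum.Base as Sum
open import Data.Vec.Base using (_∷_; here; there; _[_]≔_)
open import Data.Vec.Properties using ([]≔-updates; ≡-dec)
open import Function.Base using (_∘_)
open import Relation.Binary.Definitions using (Decidable; DecidableEquality; Symmetric)
open import Relation.Binary.PropositionalEquality
open import Relation.Nullary.Decidable using (Dec; yes; no; ¬?; _×-dec_; decidable-stable)
open import Relation.Nullary.Negation using (¬_; contradiction)

-- Lists without repetition

module _ {A : Set} (_≟ᴬ_ : DecidableEquality A) where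

  delete : A → List A → List A
  delete v = filter (¬? ∘ (v ≟ᴬ_))

  length-delete : ∀ v {xs} → Unique xs → length xs ≤ suc (length (delete v xs))
  length-delete v [] = z≤n
  length-delete v {x ∷ xs} (x∉xs ∷ xs!) with v ≟ᴬ x
  ... | yes refl = s≤s (≤-reflexive (cong length (sym (filter-all (¬? ∘ (v ≟ᴬ_)) x∉xs))))
  ... | no  _    = s≤s (length-delete v xs!)

  -- Deleting the head of `xs` from `ys` shortens `ys` but keeps the other entries of `xs`, as they
  -- differ from the head.
  Unique-⊆⇒length-≤ : ∀ {xs ys} → Unique xs → xs ⊆ ys → length xs ≤ length ys
  Unique-⊆⇒length-≤ [] _ = z≤n
  Unique-⊆⇒length-≤ {x ∷ xs} {ys} (x∉xs ∷ xs!) xs⊆ys = ≤-trans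
    (s≤s (Unique-⊆⇒length-≤ xs! λ u∈xs →
      ∈-filter⁺ (¬? ∘ (x ≟ᴬ_)) (xs⊆ys (there u∈xs)) (All.lookup x∉xs u∈xs)))
    (filter-notAll (¬? ∘ (x ≟ᴬ_)) ys (Any.map (λ eq neq → neq eq) (xs⊆ys (here refl))))

module _ {A : Set} where

  length-filter-split : ∀ {P : A → Set} (P? : ∀ x → Dec (P x)) xs →
                        length xs ≡ length (filter P? xs) + length (filter (¬? ∘ P?) xs)
  length-filter-split P? [] = refl
  length-filter-split P? (x ∷ xs) with P? x
  ... | yes _ = cong suc (length-filter-split P? xs)
  ... | no  _ = trans (cong suc (length-filter-split P? xs)) (sym (+-suc (length (filter P? xs)) _))

  AllPairs-lookup : ∀ {R : A → A → Set} → Symmetric R → ∀ {xs u v} → AllPairs R xs →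
                    u List.∈ xs → v List.∈ xs → u ≢ v → R u v
  AllPairs-lookup R-sym (_ ∷ _)  (here refl) (here refl) u≢v = contradiction refl u≢v
  AllPairs-lookup R-sym (R ∷ _)  (here refl) (there v∈)  u≢v = All.lookup R v∈
  AllPairs-lookup R-sym (R ∷ _)  (there u∈)  (here refl) u≢v = R-sym (All.lookup R u∈)
  AllPairs-lookup R-sym (_ ∷ Rs) (there u∈)  (there v∈)  u≢v = AllPairs-lookup R-sym Rs u∈ v∈ u≢v

-- The greedy argument

module _ {A : Set} where

  -- For R irreflexive: a set of k elements of W, pairwise related by R.
  Homogeneous : (A → A → Set) → ℕ → List A → Set
  Homogeneous R k W = ∃ λ C → C ⊆ W × AllPairs R C × length C ≡ k

  Homogeneous-⊆ : ∀ {R k V W} → V ⊆ W → Homogeneous R k V → Homogeneous R k W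
  Homogeneous-⊆ V⊆W (C , C⊆V , rest) = C , V⊆W ∘ C⊆V , rest

  Homogeneous-∷ : ∀ {R : A → A → Set} {k v V W} → v List.∈ W → V ⊆ W → All (R v) V →
                  Homogeneous R k V → Homogeneous R (suc k) W
  Homogeneous-∷ {v = v} v∈W V⊆W Rv (C , C⊆V , RC , ∣C∣) =
    v ∷ C , (λ { (here refl) → v∈W ; (there u∈) → V⊆W (C⊆V u∈) }) , All-resp-⊇ C⊆V Rv ∷ RC , cong suc ∣C∣

  -- With `v ≢ u` included, one definition serves a graph and its complement: for `NonAdj`,
  -- decidability of `Adj` turns the two conditions into adjacency.
  Unrelated : (A → A → Set) → ℕ → List A → Set
  Unrelated R d W = ∃₂ λ v C → v List.∈ W × C ⊆ W × Unique C × All (λ u → v ≢ u × ¬ R v u) C × d ≤ length C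

  greedy : ∀ {R : A → A → Set} → Decidable R → ∀ k d {W} → Unique W → k * d < length W →
           Homogeneous R (suc k) W ⊎ Unrelated R d W
  greedy R? zero    d {v ∷ _} _ _ = inj₁ (Homogeneous-∷ (here refl) (λ ()) [] ([] , (λ ()) , [] , refl))
  greedy {R} R? (suc k) d {v ∷ W} (v∉W ∷ W!) (s≤s kd<) with d ≤? length (filter (¬? ∘ R? v) W)
  ... | yes d≤ = inj₂ (v , filter (¬? ∘ R? v) W , here refl , there ∘ filter-⊆ (¬? ∘ R? v) W ,
          Unique.filter⁺ (¬? ∘ R? v) W! ,
          All.zip (All.filter⁺ (¬? ∘ R? v) v∉W , All.all-filter (¬? ∘ R? v) W) , d≤)
  ... | no  d≰ with greedy R? k d (Unique.filter⁺ (R? v) W!) kd<N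
    where
    open ≤-Reasoning
    -- The head `v` absorbs the strict inequality: the tail has at least `d + k * d` entries, and
    -- fewer than `d` of them are unrelated to `v`.
    kd<N : k * d < length (filter (R? v) W)
    kd<N = +-cancelˡ-< d _ _ (begin-strict
      d + k * d                                                        ≤⟨ kd< ⟩
      length W                                                         ≡⟨ length-filter-split (R? v) W ⟩
      length (filter (R? v) W) + length (filter (¬? ∘ R? v) W)         <⟨ +-monoʳ-< (length (filter (R? v) W)) (≰⇒> d≰) ⟩
      length (filter (R? v) W) + d                                     ≡⟨ +-comm _ d ⟩
      d + length (filter (R? v) W)                                     ∎)
  ...   | inj₁ clique = inj₁ (Homogeneous-∷ (here refl) (there ∘ filter-⊆ (R? v) W) (All.all-filter (R? v) W) clique)
  ...   | inj₂ (u , C , u∈ , C⊆ , rest) = inj₂ (u , C , there (filter-⊆ (R? v) W u∈) , there ∘ filter-⊆ (R? v) W ∘ C⊆ , rest)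

-- Subsets of Fin n

insert : ∀ {n} → Fin n → Subset n → Subset n
insert v T = T [ v ]≔ inside

∈-insert⁻ : ∀ {n} v (T : Subset n) {u} → u ∈ insert v T → u ≡ v ⊎ u ∈ T
∈-insert⁻ zero    (_ ∷ _) here       = inj₁ refl
∈-insert⁻ zero    (_ ∷ _) (there u∈) = inj₂ (there u∈)
∈-insert⁻ (suc v) (_ ∷ _) here       = inj₂ here
∈-insert⁻ (suc v) (_ ∷ T) (there u∈) = Sum.map (cong suc) there (∈-insert⁻ v T u∈)

-- Provides the left inverse that makes `insert v` injective on sets avoiding `v`.
insert-erase : ∀ {n} v (T : Subset n) → v ∉ T → insert v T [ v ]≔ outside ≡ T
insert-erase zero    (inside  ∷ _) v∉T = contradiction here v∉T
insert-erase zero    (outside ∷ _) v∉T = refl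
insert-erase (suc v) (b ∷ T)       v∉T = cong (b ∷_) (insert-erase v T (v∉T ∘ there))

∣insert∣ : ∀ {n} v (T : Subset n) → v ∉ T → ∣ insert v T ∣ ≡ suc ∣ T ∣
∣insert∣ zero    (inside  ∷ _) v∉T = contradiction here v∉T
∣insert∣ zero    (outside ∷ _) v∉T = refl
∣insert∣ (suc v) (inside  ∷ T) v∉T = cong suc (∣insert∣ v T (v∉T ∘ there))
∣insert∣ (suc v) (outside ∷ T) v∉T = ∣insert∣ v T (v∉T ∘ there)

fromList : ∀ {n} → List (Fin n) → Subset n
fromList = foldr insert ∅

∈-fromList⁻ : ∀ {n} {u : Fin n} vs → u ∈ fromList vs → u List.∈ vs
∈-fromList⁻ []       u∈ = contradiction u∈ ∉⊥
∈-fromList⁻ (v ∷ vs) u∈ with ∈-insert⁻ v (fromList vs) u∈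
... | inj₁ refl = here refl
... | inj₂ u∈vs = there (∈-fromList⁻ vs u∈vs)

∣fromList∣ : ∀ {n} {vs : List (Fin n)} → Unique vs → ∣ fromList vs ∣ ≡ length vs
∣fromList∣ {n} [] = ∣⊥∣≡0 n
∣fromList∣ {vs = v ∷ vs} (v∉vs ∷ vs!) =
  trans (∣insert∣ v (fromList vs) λ v∈ → All.lookup v∉vs (∈-fromList⁻ vs v∈) refl) (cong suc (∣fromList∣ vs!))

-- Bounds on natural numbers

^-distribʳ-* : ∀ a b n → (a * b) ^ n ≡ a ^ n * b ^ n
^-distribʳ-* a b zero    = refl
^-distribʳ-* a b (suc n) = trans (cong (a * b *_) (^-distribʳ-* a b n))
  (solve 4 (λ a b c d → a :* b :* (c :* d) := a :* c :* (b :* d)) refl a b (a ^ n) (b ^ n))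
  where open +-*-Solver

-- Raising `m` by one either stays below `f (suc k)` or lands on it exactly; in the second case `k`
-- advances by one.
bracket : ∀ (f : ℕ → ℕ) → (∀ k → f k < f (suc k)) → ∀ {m} → f 0 ≤ m → ∃ λ k → f k ≤ m × m < f (suc k)
bracket f f-mono {zero}  f0≤ = 0 , f0≤ , ≤-<-trans z≤n (f-mono 0)
bracket f f-mono {suc m} f0≤ with m≤n⇒m<n∨m≡n f0≤
... | inj₂ f0≡ = 0 , f0≤ , subst (_< f 1) f0≡ (f-mono 0)
... | inj₁ (s≤s f0≤m) with bracket f f-mono f0≤m
...   | k , fk≤ , <fk+1 with m≤n⇒m<n∨m≡n <fk+1
...     | inj₁ lt = k , m≤n⇒m≤1+n fk≤ , lt
...     | inj₂ eq = suc k , ≤-reflexive (sym eq) , subst (_< f (suc (suc k))) (sym eq) (f-mono (suc k))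

growth : ℕ → ℕ → ℕ
growth r zero    = 1
growth r (suc i) = r * (2 * r) ^ i * growth r i

-- After squaring, the recursion contributes `r * r * q ^ (2 * i)` with `q = 2 * r`, and
-- `r * r ≥ 2 * r` supplies the last factor `q`.
square-growth : ∀ {r} → 2 ≤ r → ∀ i → (2 * r) ^ (i * i) ≤ growth r i * growth r i
square-growth     2≤r zero    = ≤-refl
square-growth {r} 2≤r (suc i) = begin
  q ^ (suc i * suc i)                     ≡⟨ cong (q ^_) (solve 1 (λ i → (con 1 :+ i) :* (con 1 :+ i) := con 1 :+ (i :+ i :+ i :* i)) refl i) ⟩
  q * q ^ (i + i + i * i)                 ≡⟨ cong (q *_) (trans (^-distribˡ-+-* q (i + i) (i * i)) (cong (_* q ^ (i * i)) (^-distribˡ-+-* q i i))) ⟩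
  q * (q ^ i * q ^ i * q ^ (i * i))       ≤⟨ *-mono-≤ (*-monoˡ-≤ r 2≤r) (*-monoʳ-≤ (q ^ i * q ^ i) (square-growth 2≤r i)) ⟩
  r * r * (q ^ i * q ^ i * (g * g))       ≡⟨ solve 3 (λ r p g → r :* r :* (p :* p :* (g :* g)) := r :* p :* g :* (r :* p :* g)) refl r (q ^ i) g ⟩
  r * q ^ i * g * (r * q ^ i * g)         ∎
  where
  open ≤-Reasoning
  open +-*-Solver
  q g : ℕ
  q = 2 * r
  g = growth r i

-- Independent sets of a graph

module _ {n : ℕ} (G : Graph n) where
  open Graph G

  -- Adjacency in the complement graph, irreflexive because of `u ≢ v`.
  NonAdj : Fin n → Fin n → Set
  NonAdj u v = u ≢ v × ¬ Adj u v

  nonAdj? : Decidable NonAdj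
  nonAdj? u v = ¬? (u Fin.≟ v) ×-dec ¬? (adj? u v)

  -- Pairwise adjacent entries are distinct by irreflexivity, so `fromList` loses none of the `r`
  -- vertices.
  K-free⇒¬Homogeneous : ∀ {r W} → K[ r ]-Free G → ¬ Homogeneous Adj r W
  K-free⇒¬Homogeneous free (C , _ , adj , ∣C∣) = free
    ( fromList C
    , trans (∣fromList∣ (AllPairs.map (λ uv u≡v → adj-irrefl u≡v uv) adj)) ∣C∣
    , λ u v u∈ v∈ → AllPairs-lookup adj-sym adj (∈-fromList⁻ C u∈) (∈-fromList⁻ C v∈))

  -- Induction on the clique size. `greedy` runs on the complement, so an unrelated set consists of
  -- neighbours of `v`, and a clique found in it extends by `v`.
  ramsey : ∀ s k {W} → Unique W → suc s ^ k ≤ length W →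
           Homogeneous Adj (suc k) W ⊎ Homogeneous NonAdj (suc s) W
  ramsey s zero    {v ∷ _} _ _ = inj₁ (Homogeneous-∷ (here refl) (λ ()) [] ([] , (λ ()) , [] , refl))
  -- `s * suc s ^ k` falls short of `suc s ^ suc k` by the positive term `suc s ^ k`.
  ramsey s (suc k) {W} W! large with greedy nonAdj? s (suc s ^ k) W! (<-≤-trans (m<n+m _ (m^n>0 (suc s) k)) large)
  ... | inj₁ independent = inj₂ independent
  ... | inj₂ (v , C , v∈W , C⊆W , C! , related , C-large) with ramsey s k C! C-large
  ...   | inj₂ independent = inj₂ (Homogeneous-⊆ C⊆W independent)
  ...   | inj₁ clique      = inj₁ (Homogeneous-∷ v∈W C⊆W
            (All.map (λ {u} (v≢u , ¬na) → decidable-stable (adj? v u) λ ¬adj → ¬na (v≢u , ¬adj)) related) clique)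

  -- Families of independent sets

  IndependentIn : List (Fin n) → Subset n → Set
  IndependentIn W T = Independent G T × (∀ {u} → u ∈ T → u List.∈ W)

  record Family (W : List (Fin n)) (N : ℕ) : Set where
    field
      sets        : List (Subset n)
      unique      : Unique sets
      independent : All (IndependentIn W) sets
      size        : length sets ≡ N

  open Family

  Family⇒≤ : ∀ {W N} → Family W N → N ≤ numIndependentSets G
  Family⇒≤ F = subst (_≤ numIndependentSets G) (size F)
    (Unique-⊆⇒length-≤ (≡-dec Bool._≟_) (unique F) λ T∈ →
      ∈-filter⁺ (independent? G) (∈-subsets _) (proj₁ (All.lookup (independent F) T∈)))

  empty : ∀ {W} → Family W 0
  empty = record { sets = [] ; unique = [] ; independent = [] ; size = refl }

  singleton : ∀ {W} → Family W 1
  singleton = record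
    { sets        = ∅ ∷ []
    ; unique      = [] ∷ []
    ; independent = ((λ _ _ u∈ → contradiction u∈ ∉⊥) , λ u∈ → contradiction u∈ ∉⊥) ∷ []
    ; size        = refl
    }

  -- The sets avoiding v come from V, those containing v arise from C by inserting v.
  branch : ∀ {v V C W a b} → v List.∈ W → V ⊆ W → C ⊆ W → v List.∉ V → All (NonAdj v) C →
           Family V a → Family C b → Family W (a + b)
  branch {v} {V} {C} {W} v∈W V⊆W C⊆W v∉V apart F E = record
    { sets        = sets F ++ map (insert v) (sets E)
    ; unique      = AllPairs.++⁺ (unique F)
                      (AllPairs.map (λ ne eq → ne (cong (_[ v ]≔ outside) eq)) (AllPairs.map⁻ erased!))
                      (All.map (λ { (_ , T⊆V) → All.map⁺ (All.universal (λ T′ T≡ →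
                        v∉V (T⊆V (subst (v ∈_) (sym T≡) ([]≔-updates T′ v)))) (sets E)) }) (independent F))
    ; independent = All.++⁺ (All.map widened (independent F))
                      (All.map⁺ (All.map inserted (independent E)))
    ; size        = trans (length-++ (sets F)) (cong₂ _+_ (size F) (trans (length-map (insert v) (sets E)) (size E)))
    }
    where
    -- Erasing `v` turns the inserted sets back into `sets E`, since `apart` keeps `v` out of `C`;
    -- distinctness then passes from the erased sets to the inserted ones.
    erased! : Unique (map (_[ v ]≔ outside) (map (insert v) (sets E)))
    erased! = subst Unique (sym (trans (sym (map-∘ (sets E))) (map-id-local
      (All.map (λ {T} (_ , T⊆C) → insert-erase v T λ v∈T → proj₁ (All.lookup apart (T⊆C v∈T)) refl) (independent E)))))
      (unique E)

    widened : ∀ {T} → IndependentIn V T → IndependentIn W T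
    widened (ind , T⊆V) = ind , λ u∈ → V⊆W (T⊆V u∈)

    inserted : ∀ {T} → IndependentIn C T → IndependentIn W (insert v T)
    inserted {T} (ind , T⊆C) = ind′ , T⊆W
      where
      T⊆W : ∀ {u} → u ∈ insert v T → u List.∈ W
      T⊆W u∈ with ∈-insert⁻ v T u∈
      ... | inj₁ refl = v∈W
      ... | inj₂ u∈T  = C⊆W (T⊆C u∈T)

      ind′ : Independent G (insert v T)
      ind′ u w u∈ w∈ uw with ∈-insert⁻ v T u∈ | ∈-insert⁻ v T w∈
      ... | inj₁ refl | inj₁ refl = adj-irrefl refl uw
      ... | inj₁ refl | inj₂ w∈T  = proj₂ (All.lookup apart (T⊆C w∈T)) uw
      ... | inj₂ u∈T  | inj₁ refl = proj₂ (All.lookup apart (T⊆C u∈T)) (adj-sym uw)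
      ... | inj₂ u∈T  | inj₂ w∈T  = ind u w u∈T w∈T uw

  -- Each vertex doubles the count: it is non-adjacent to all later ones, so the same family serves
  -- both branches.
  powerFamily : ∀ {C} → AllPairs NonAdj C → Family C (2 ^ length C)
  powerFamily [] = singleton
  powerFamily {v ∷ C} (apart ∷ C-apart) = subst (Family (v ∷ C)) (cong (λ m → 2 ^ length C + m) (sym (+-identityʳ _)))
    (branch (here refl) there there (λ v∈C → proj₁ (All.lookup apart v∈C) refl) apart F F)
    where
    F : Family C (2 ^ length C)
    F = powerFamily C-apart

  -- Each of the `j` rounds finds `v` with at least `d` non-neighbours, gains `N` sets containing
  -- `v`, and deletes `v`. At the start of every round more than `k * d` vertices are left, as
  -- `greedy` requires.
  multiply : ∀ k d N →
             (∀ {W} → Unique W → ¬ Homogeneous Adj (suc k) W → d ≤ length W → Family W N) →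
             ∀ j {W} → Unique W → ¬ Homogeneous Adj (suc k) W → k * d + j ≤ length W → Family W (j * N)
  multiply k d N F zero    W! free large = empty
  multiply k d N F (suc j) {W} W! free large with greedy adj? k d W! (<-≤-trans (m<m+n (k * d) (s≤s z≤n)) large)
  ... | inj₁ clique = ⊥-elim (free clique)
  ... | inj₂ (v , C , v∈W , C⊆W , C! , apart , C-large) = subst (Family W) (+-comm (j * N) N)
    (branch v∈W (filter-⊆ (¬? ∘ (v Fin.≟_)) W) C⊆W
      (λ v∈ → proj₂ (∈-filter⁻ (¬? ∘ (v Fin.≟_)) {xs = W} v∈) refl) apart
      (multiply k d N F j (Unique.filter⁺ (¬? ∘ (v Fin.≟_)) {W} W!)
        (free ∘ Homogeneous-⊆ (filter-⊆ (¬? ∘ (v Fin.≟_)) W))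
        (≤-pred (≤-trans (≤-reflexive (sym (+-suc (k * d) j))) (≤-trans large (length-delete Fin._≟_ v W!)))))
      (F C! (free ∘ Homogeneous-⊆ C⊆W) C-large))

  growthFamily : ∀ k i {W} → Unique W → ¬ Homogeneous Adj (suc k) W → (2 * suc k) ^ i ≤ length W →
                 Family W (growth (suc k) i)
  growthFamily k zero    W! free large = singleton
  -- The `k * q ^ i` vertices held in reserve for `greedy` and the `suc k * q ^ i` rounds together
  -- fit into `q ^ suc i`.
  growthFamily k (suc i) W! free large = multiply k (q ^ i) (growth (suc k) i) (growthFamily k i) (suc k * q ^ i) W! free
    (≤-trans (begin
      k * q ^ i + suc k * q ^ i      ≤⟨ +-monoˡ-≤ (suc k * q ^ i) (m≤n+m (k * q ^ i) (q ^ i)) ⟩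
      suc k * q ^ i + suc k * q ^ i  ≡⟨ *-distribʳ-+ (q ^ i) (suc k) (suc k) ⟨
      (suc k + suc k) * q ^ i        ≡⟨ cong (λ m → (suc k + m) * q ^ i) (+-identityʳ (suc k)) ⟨
      q * q ^ i                      ∎) large)
    where
    open ≤-Reasoning
    q : ℕ
    q = 2 * suc k

  -- The two bounds for the whole graph

  whole! : Unique (allFin n)
  whole! = Unique.allFin⁺ n

  ∣whole∣ : length (allFin n) ≡ n
  ∣whole∣ = length-tabulate {n = n} (λ i → i)

  ℐ : ℕ
  ℐ = numIndependentSets G

  independence-bound : ∀ {r} → 1 < r → 1 ≤ n → K[ r ]-Free G → ∃ λ α → n ≤ (2 * α) ^ r × 2 ^ α ≤ ℐ
  independence-bound {r@(suc (suc k))} (s≤s (s≤s _)) 1≤n free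
    with bracket (λ s → suc s ^ suc k) (λ s → ^-monoˡ-< (suc k) (n<1+n (suc s)))
           (≤-trans (≤-reflexive (^-zeroˡ (suc k))) 1≤n)
  ... | s , large , small with ramsey s (suc k) whole! (subst (suc s ^ suc k ≤_) (sym ∣whole∣) large)
  ...   | inj₁ clique = ⊥-elim (K-free⇒¬Homogeneous free clique)
  ...   | inj₂ (C , _ , apart , ∣C∣) =
          suc s , bound , subst (λ a → 2 ^ a ≤ ℐ) ∣C∣ (Family⇒≤ (powerFamily apart))
    where
    open ≤-Reasoning
    -- Here `α = suc s ≥ 1`, so `α + 1 ≤ 2 * α`; raising the exponent from `r - 1` to `r` then costs
    -- nothing.
    bound : n ≤ (2 * suc s) ^ r
    bound = begin
      n                        ≤⟨ <⇒≤ small ⟩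
      suc (suc s) ^ suc k      ≤⟨ ^-monoˡ-≤ (suc k) (+-mono-≤ (s≤s z≤n) (m≤m+n (suc s) 0)) ⟩
      (2 * suc s) ^ suc k      ≤⟨ ^-monoʳ-≤ (2 * suc s) (n≤1+n (suc k)) ⟩
      (2 * suc s) ^ r          ∎

  -- With `d = 0` and `N = 1` there is room for `n` rounds, each contributing the one-vertex set of
  -- its `v`.
  order≤ℐ : ∀ {r} → 1 < r → K[ r ]-Free G → n ≤ ℐ
  order≤ℐ {suc k} (s≤s _) free = subst (_≤ ℐ) (*-identityʳ n) (Family⇒≤
    (multiply k 0 1 (λ _ _ _ → singleton) n whole! (K-free⇒¬Homogeneous free)
      (≤-reflexive (trans (cong (_+ n) (*-zeroʳ k)) (sym ∣whole∣)))))

  growth-bound : ∀ {r} → 1 < r → 1 ≤ n → K[ r ]-Free G →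
                 ∃ λ i → n ≤ (2 * r) ^ suc i × n ^ suc i ≤ ℐ ^ 18
  growth-bound {r@(suc k)} 1<r 1≤n free
    with bracket ((2 * r) ^_) (λ i → ^-monoʳ-< (2 * r) (≤-trans 1<r (m≤m+n r _)) (n<1+n i)) 1≤n
  -- For `i = 0` the estimate `suc i ≤ 3 * i` fails, so the linear bound replaces the growth bound.
  ... | zero  , large , small = 0 , <⇒≤ small , (begin
      n ^ 1   ≡⟨ ^-identityʳ n ⟩
      n       ≤⟨ order≤ℐ 1<r free ⟩
      ℐ       ≡⟨ ^-identityʳ ℐ ⟨
      ℐ ^ 1   ≤⟨ ^-monoʳ-≤ ℐ {{>-nonZero (≤-trans 1≤n (order≤ℐ 1<r free))}} {1} {18} (s≤s z≤n) ⟩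
      ℐ ^ 18  ∎)
    where open ≤-Reasoning
  ... | i@(suc j) , large , small = i , <⇒≤ small , (begin
      n ^ s                ≤⟨ ^-monoˡ-≤ s (<⇒≤ small) ⟩
      (q ^ s) ^ s          ≡⟨ ^-*-assoc q s s ⟩
      q ^ (s * s)          ≤⟨ ^-monoʳ-≤ q (≤-trans (*-mono-≤ s≤3i s≤3i) (≤-reflexive
                               (solve 1 (λ i → (con 3 :* i) :* (con 3 :* i) := i :* i :* con 9) refl i))) ⟩
      q ^ (i * i * 9)      ≡⟨ ^-*-assoc q (i * i) 9 ⟨
      -- The exponent 18 is 9 from squaring `s ≤ 3 * i`, times 2 from squaring `growth r i ≤ ℐ`.
      (q ^ (i * i)) ^ 9    ≤⟨ ^-monoˡ-≤ 9 (≤-trans (square-growth 1<r i) (*-mono-≤ growth≤ℐ growth≤ℐ)) ⟩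
      (ℐ * ℐ) ^ 9          ≡⟨ cong (λ m → (ℐ * m) ^ 9) (sym (*-identityʳ ℐ)) ⟩
      (ℐ ^ 2) ^ 9          ≡⟨ ^-*-assoc ℐ 2 9 ⟩
      ℐ ^ 18               ∎)
    where
    open ≤-Reasoning
    open +-*-Solver
    q s : ℕ
    q = 2 * r
    s = suc i
    s≤3i : s ≤ 3 * i
    s≤3i = +-mono-≤ (s≤s (z≤n {j})) (m≤m+n i (i + 0))
    growth≤ℐ : growth r i ≤ ℐ
    growth≤ℐ = Family⇒≤ (growthFamily k i whole! (K-free⇒¬Homogeneous free) (subst (q ^ i ≤_) (sym ∣whole∣) large))

-- Comparison of the reals involved with rationals

open ℝ⁺

lower-≤0 : ∀ x {q} → q ℚ.≤ 0ℚ → Lower x q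
lower-≤0 x q≤0 = let (a , 0<a , La) = lower-open x (lower-0 x) in lower-down x (ℚ.≤-<-trans q≤0 0<a) La

fraction-* : ∀ m p k → fraction m 0 ℚ.* fraction p k ≡ fraction (m * p) k
fraction-* m p k = ℚ.toℚᵘ-injective (begin
  toℚᵘ (fraction m 0 ℚ.* fraction p k)               ≈⟨ ℚ.toℚᵘ-homo-* (fraction m 0) (fraction p k) ⟩
  toℚᵘ (fraction m 0) ℚᵘ.* toℚᵘ (fraction p k)       ≈⟨ ℚᵘ.*-cong (ℚ.toℚᵘ-fromℚᵘ (ℚᵘ.mkℚᵘ (ℤ.+ m) 0)) (ℚ.toℚᵘ-fromℚᵘ (ℚᵘ.mkℚᵘ (ℤ.+ p) k)) ⟩
  ℚᵘ.mkℚᵘ (ℤ.+ m) 0 ℚᵘ.* ℚᵘ.mkℚᵘ (ℤ.+ p) k               ≈⟨ ℚᵘ.*≡* (cong₂ ℤ._*_ (sym (ℤ.pos-* m p)) (cong (ℤ.+_ ∘ suc) (sym (+-identityʳ k)))) ⟩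
  ℚᵘ.mkℚᵘ (ℤ.+ (m * p)) k                              ≈⟨ ℚ.toℚᵘ-fromℚᵘ (ℚᵘ.mkℚᵘ (ℤ.+ (m * p)) k) ⟨
  toℚᵘ (fraction (m * p) k)                          ∎)
  where open ℚᵘ.≃-Reasoning

-- `fraction` takes the predecessor of a denominator, and `k + n * suc k` is the predecessor of
-- `suc n * suc k`.
fraction-cancel : ∀ n p k → fraction (suc n) 0 ℚ.* fraction p (k + n * suc k) ≡ fraction p k
fraction-cancel n p k = trans (fraction-* (suc n) p (k + n * suc k))
  (ℚ.≤-antisym (fraction-≤ (suc n * p) (k + n * suc k) p k (≤-reflexive eq))
               (fraction-≤ p k (suc n * p) (k + n * suc k) (≤-reflexive (sym eq))))
  where
  open +-*-Solver
  eq : suc n * p * suc k ≡ p * (suc n * suc k)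
  eq = solve 3 (λ n p k → n :* p :* k := p :* (n :* k)) refl (suc n) p (suc k)

fraction-pos : ∀ n → 0ℚ ℚ.< fraction (suc n) 0
fraction-pos n = ℚ.<-≤-trans (ℚ.*<* (ℤ.+<+ (s≤s z≤n))) (fraction-≤ 1 0 (suc n) 0 (s≤s z≤n))

fromℕ-upper : ∀ n .{{_ : NonZero n}} {b} → Upper (fromℕ n) b → fraction n 0 ℚ.< b
fromℕ-upper n (p , k , n≤p/k , p/k<b) =
  ℚ.≤-<-trans (fraction-≤ n 0 p k (≤-trans n≤p/k (≤-reflexive (sym (*-identityʳ p))))) p/k<b

-- The hypothesis encodes `(m + 1) log x ≤ (n + 1) log y`; accordingly a fraction witnessing `a`
-- below `log₂ x` is multiplied by `(m + 1) / (n + 1)`.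
log₂-rescale : ∀ {x y} .{{_ : NonTrivial x}} .{{_ : NonTrivial y}} m n → x ^ suc m ≤ y ^ suc n →
               ∀ {a c} → Lower (log₂ x) a → fraction (suc n) 0 ℚ.* c ℚ.≤ fraction (suc m) 0 ℚ.* a → Lower (log₂ y) c
log₂-rescale {x} {y} m n x≤y {a} {c} (p , k , 2^p≤x^k , a<p/k) nc≤ma =
  suc m * p , k + n * suc k , exponents ,
  *ʳ-cancel-< c _ N (fraction-pos n) (subst₂ ℚ._<_ (ℚ.*-comm N c)
    (trans (sym (trans (fraction-cancel n (suc m * p) k) (sym (fraction-* (suc m) p k)))) (ℚ.*-comm N _))
    (ℚ.≤-<-trans nc≤ma (*ˡ-< a (fraction p k) (fraction (suc m) 0) (fraction-pos m) a<p/k)))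
  where
  open ≤-Reasoning
  N : ℚ
  N = fraction (suc n) 0
  exponents : 2 ^ (suc m * p) ≤ y ^ (suc n * suc k)
  exponents = begin
    2 ^ (suc m * p)         ≡⟨ cong (2 ^_) (*-comm (suc m) p) ⟩
    2 ^ (p * suc m)         ≡⟨ ^-*-assoc 2 p (suc m) ⟨
    (2 ^ p) ^ suc m         ≤⟨ ^-monoˡ-≤ (suc m) 2^p≤x^k ⟩
    (x ^ suc k) ^ suc m     ≡⟨ ^-*-assoc x (suc k) (suc m) ⟩
    x ^ (suc k * suc m)     ≡⟨ cong (x ^_) (*-comm (suc k) (suc m)) ⟩
    x ^ (suc m * suc k)     ≡⟨ ^-*-assoc x (suc m) (suc k) ⟨
    (x ^ suc m) ^ suc k     ≤⟨ ^-monoˡ-≤ (suc k) x≤y ⟩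
    (y ^ suc n) ^ suc k     ≡⟨ ^-*-assoc y (suc n) (suc k) ⟩
    y ^ (suc n * suc k)     ∎

-- Dividing `a` by `n + 1` gives a rational that `log₂-rescale` with `m = 0` puts below `log₂ y`,
-- hence below `b`.
log₂-≤-scaled : ∀ {x y} .{{_ : NonTrivial x}} .{{_ : NonTrivial y}} n → x ≤ y ^ suc n →
                ∀ {a b} → Lower (log₂ x) a → Upper (log₂ y) b → a ℚ.< fraction (suc n) 0 ℚ.* b
log₂-≤-scaled {x} {y} n x≤y {a} {b} La Ub with quotient a (fraction-pos n)
... | c , cN≡a = subst₂ ℚ._<_ cN≡a (ℚ.*-comm b N) (*ʳ-< c b N (fraction-pos n)
  (lower<upper (log₂ y) (log₂-rescale 0 n (≤-trans (≤-reflexive (^-identityʳ x)) x≤y) La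
    (ℚ.≤-reflexive (trans (ℚ.*-comm N c) (trans cN≡a (sym 1*a≡a))))) Ub))
  where
  N : ℚ
  N = fraction (suc n) 0
  1*a≡a : fraction 1 0 ℚ.* a ≡ a
  1*a≡a = trans (cong (ℚ._* a) {fraction 1 0} {ℚ.1ℚ} refl) (ℚ.*-identityˡ a)

-- The integer `α` separates the two sides: half the root is at most `α`, which is at most `log y`.
root/2≤log₂ : ∀ {r x y α} .{{_ : NonZero r}} .{{_ : NonZero x}} .{{_ : NonTrivial y}} →
              x ≤ (2 * α) ^ r → 2 ^ α ≤ y → root r x /ᴿ fromℕ 2 ≤ᴿ log₂ y
root/2≤log₂ {r} {x} {y} {α} x≤ 2^α≤y q (a , b , (p , k , p^r≤ , a<p/k) , Ub , qb<a) with 0ℚ ℚ.<? q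
... | no  0≮q = lower-≤0 (log₂ y) (ℚ.≮⇒≥ 0≮q)
... | yes 0<q = α , 0 , ≤-trans 2^α≤y (≤-reflexive (sym (^-identityʳ y))) , *ʳ-cancel-< q (fraction α 0) 2ℚ (fraction-pos 1) (begin-strict
    q ℚ.* 2ℚ                <⟨ *ˡ-< 2ℚ b q 0<q (fromℕ-upper 2 Ub) ⟩
    q ℚ.* b                 <⟨ qb<a ⟩
    a                       <⟨ a<p/k ⟩
    fraction p k            ≤⟨ fraction-≤ p k (α * 2) 0 (≤-trans (≤-reflexive (*-identityʳ p)) (≤-trans p≤ (≤-reflexive (cong (_* suc k) (*-comm 2 α))))) ⟩
    fraction (α * 2) 0      ≡⟨ fraction-* α 2 0 ⟨
    fraction α 0 ℚ.* 2ℚ     ∎)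
  where
  open ℚ.≤-Reasoning
  2ℚ : ℚ
  2ℚ = fraction 2 0
  -- Comparison of `r`-th powers: `p ^ r ≤ x * suc k ^ r ≤ (2 * α * suc k) ^ r`.
  p≤ : p ≤ 2 * α * suc k
  p≤ = ≮⇒≥ λ lt → <⇒≱ (^-monoˡ-< r lt) (≤-trans p^r≤ (≤-trans (*-monoˡ-≤ (suc k ^ r) x≤)
         (≤-reflexive (sym (^-distribʳ-* (2 * α) (suc k) r)))))

-- One factor `log x` is bounded by `s log q` with `s = i + 1`, and `log q` cancels, leaving
-- `18 c < s log x`. The hypothesis on powers bounds `s log x` by `18 log y`.
log₂²/18log₂≤log₂ : ∀ {x q y} .{{_ : NonTrivial x}} .{{_ : NonTrivial q}} .{{_ : NonTrivial y}} i →
                    x ≤ q ^ suc i → x ^ suc i ≤ y ^ 18 → (log₂ x) ² /ᴿ (fromℕ 18 *ᴿ log₂ q) ≤ᴿ log₂ y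
log₂²/18log₂≤log₂ {x} {q} {y} i x≤ ≤y c
  (a , b , (a₁ , a₂ , 0<a₁ , La₁ , 0<a₂ , La₂ , a<a₁a₂) , (b₁ , b₂ , Ub₁ , Ub₂ , b₁b₂<b) , cb<a) with 0ℚ ℚ.<? c
-- A non-positive `c` lies below every positive real; the other case multiplies inequalities by `c`
-- and needs `0 < c`.
... | no  0≮c = lower-≤0 (log₂ y) (ℚ.≮⇒≥ 0≮c)
... | yes 0<c = log₂-rescale i 17 ≤y La₁ (ℚ.<⇒≤ (*ʳ-cancel-< _ _ b₂ 0<b₂ (begin-strict
    18ℚ ℚ.* c ℚ.* b₂      ≡⟨ solve 3 (λ e c b → e :* c :* b := c :* (e :* b)) refl 18ℚ c b₂ ⟩
    c ℚ.* (18ℚ ℚ.* b₂)    <⟨ *ˡ-< _ _ c 0<c (*ʳ-< 18ℚ b₁ b₂ 0<b₂ (fromℕ-upper 18 Ub₁)) ⟩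
    c ℚ.* (b₁ ℚ.* b₂)     <⟨ *ˡ-< _ _ c 0<c b₁b₂<b ⟩
    c ℚ.* b               <⟨ cb<a ⟩
    a                     <⟨ a<a₁a₂ ⟩
    a₁ ℚ.* a₂             <⟨ *ˡ-< a₂ (s ℚ.* b₂) a₁ 0<a₁ (log₂-≤-scaled i x≤ La₂ Ub₂) ⟩
    a₁ ℚ.* (s ℚ.* b₂)     ≡⟨ solve 3 (λ a s b → a :* (s :* b) := s :* a :* b) refl a₁ s b₂ ⟩
    s ℚ.* a₁ ℚ.* b₂       ∎)))
  where
  open ℚ.≤-Reasoning
  open ℚ-Solver.+-*-Solver
  18ℚ s : ℚ
  18ℚ = fraction 18 0
  s = fraction (suc i) 0
  0<b₂ : 0ℚ ℚ.< b₂
  0<b₂ = upper-pos (log₂ q) Ub₂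

mainTheorem3 : (r x : ℕ) → .{{_ : NonTrivial r}} → .{{_ : NonTrivial x}} →
    (G : Graph x) → K[ r ]-Free G →
    (root r x {{nonTrivial⇒nonZero r}} {{nonTrivial⇒nonZero x}} /ᴿ fromℕ 2)
    ⊔ᴿ ((log₂ x) ² /ᴿ (fromℕ 18 *ᴿ log₂ (2 * r) {{2*-nonTrivial r}}))
    ≤ᴿ log₂ (numIndependentSets G) {{numIndependentSets-nonTrivial G}}
mainTheorem3 r x {{r>1}} {{x>1}} G free c = Sum.[
    (let (α , x≤ , ≤ℐ) = independence-bound G 1<r 1≤x free
     in root/2≤log₂ {α = α} {{nonTrivial⇒nonZero r}} {{nonTrivial⇒nonZero x}} {{numIndependentSets-nonTrivial G}} x≤ ≤ℐ c)
  , (let (i , x≤ , ≤ℐ) = growth-bound G 1<r 1≤x free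
     in log₂²/18log₂≤log₂ {{x>1}} {{2*-nonTrivial r}} {{numIndependentSets-nonTrivial G}} i x≤ ≤ℐ c)
  ]
  where
  1<r : 1 < r
  1<r = nonTrivial⇒n>1 r
  1≤x : 1 ≤ x
  1≤x = <⇒≤ (nonTrivial⇒n>1 x)
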